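{- $\mathbf{cov}(\mathcal{L}) \leq \text{\ss}$, where $\mathbf{cov}(\mathcal{L})$ is the covering number of the Lebesgue null ideal and $\text{\ss}$ is the subseries number.
   Context: $\mathbb{N}=\{1,2,3,\dots\}$. For $A\subseteq\mathbb{N}$, the subseries $\sum_{n\in A}a_n$ is summed in increasing order of the indices; if $A$ is finite it is a finite sum and counts as convergent. A series is conditionally convergent if it converges but not absolutely. The subseries number $\text{\ss}$ is the smallest cardinality of a family $\mathcal{A}$ of subsets of $\mathbb{N}$ such that for every conditionally convergent series $\sum_{n\in\mathbb{N}}a_n$ of real numbers there is $A\in\mathcal{A}$ such that $\sum_{n\in A}a_n$ diverges. The Lebesgue measure on the Cantor space $2^{\mathbb{N}}$ is the product measure in which each set $\{s\in 2^{\mathbb{N}}: s(n)=i\}$ ($n\in\mathbb{N}$, $i\in\{0,1\}$) has measure $1/2$. $\mathbf{cov}(\mathcal{L})$ is the smallest cardinality of a collection of Lebesgue-measure-zero subsets of $2^{\mathbb{N}}$ whose union is $2^{\mathbb{N}}$. -}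

module Defs where

open import Data.Bool using (Bool; if_then_else_)
open import Data.Fin using (Fin; toℕ)
open import Data.List using (List; []; _∷_; length; lookup)
open import Data.Nat as ℕ using (ℕ; zero; suc)
import Data.Nat.Properties as ℕ
open import Data.Product using (∃; _×_; _,_)
open import Data.Rational as ℚ using (ℚ; 0ℚ; 1ℚ; ½)
import Data.Rational.Properties as ℚ
open import Data.Rational.Solver using (module +-*-Solver)
open import Function.Bundles using (_↣_)
open import Data.Sum using (inj₁; inj₂)
open import Level as Level using (0ℓ; _⊔_)
open import Relation.Binary.PropositionalEquality using (_≡_; refl; sym; cong; subst)
open import Relation.Nullary using (¬_)
open import Relation.Unary using (Pred; _∈_)

-- Index n of the code is index n + 1 of a series or binary sequence indexed
-- by {1,2,3,…}.

-- partialSum _∙_ ε f n = f 0 ∙ … ∙ f (n - 1)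
partialSum : ∀ {a} {A : Set a} → (A → A → A) → A → (ℕ → A) → ℕ → A
partialSum _∙_ ε f zero    = ε
partialSum _∙_ ε f (suc n) = partialSum _∙_ ε f n ∙ f n

-- Two representatives x, y denote the same real when x ≤ y and y ≤ x.  This
-- equality is not needed below: everything is expressed through _≤_, which
-- respects it.
record ℝ : Set where
  constructor mkℝ
  field
    seq    : ℕ → ℚ
    cauchy : ∀ ε → 0ℚ ℚ.< ε →
             ∃ λ N → ∀ m n → N ℕ.≤ m → N ℕ.≤ n → ℚ.∣ seq m ℚ.- seq n ∣ ℚ.≤ ε

open ℝ public

private
  half>0 : ∀ {ε} → 0ℚ ℚ.< ε → 0ℚ ℚ.< ½ ℚ.* ε
  half>0 {ε} ε>0 = subst (ℚ._< ½ ℚ.* ε) (ℚ.*-zeroʳ ½) (ℚ.*-monoʳ-<-pos ½ ε>0)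

  half+half : ∀ ε → ½ ℚ.* ε ℚ.+ ½ ℚ.* ε ≡ ε
  half+half = solve 1 (λ ε → con ½ :* ε :+ con ½ :* ε := ε) refl
    where open +-*-Solver

  interchange : ∀ a b c d →
                (a ℚ.+ b) ℚ.- (c ℚ.+ d) ≡ (a ℚ.- c) ℚ.+ (b ℚ.- d)
  interchange = solve 4 (λ a b c d →
    (a :+ b) :- (c :+ d) := (a :- c) :+ (b :- d)) refl
    where open +-*-Solver

  neg-minus : ∀ a b → (ℚ.- a) ℚ.- (ℚ.- b) ≡ ℚ.- (a ℚ.- b)
  neg-minus = solve 2 (λ a b → (:- a) :- (:- b) := :- (a :- b)) refl
    where open +-*-Solver

  minus-plus : ∀ p q → (p ℚ.- q) ℚ.+ q ≡ p
  minus-plus = solve 2 (λ p q → (p :- q) :+ q := p) refl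
    where open +-*-Solver

  plus-minus : ∀ p q → (p ℚ.+ q) ℚ.- q ≡ p
  plus-minus = solve 2 (λ p q → (p :+ q) :- q := p) refl
    where open +-*-Solver

  neg-swap : ∀ p q → ℚ.- (p ℚ.- q) ≡ q ℚ.- p
  neg-swap = solve 2 (λ p q → :- (p :- q) := q :- p) refl
    where open +-*-Solver

  ∣p∣-∣q∣≤∣p-q∣ : ∀ p q → ℚ.∣ p ∣ ℚ.- ℚ.∣ q ∣ ℚ.≤ ℚ.∣ p ℚ.- q ∣
  ∣p∣-∣q∣≤∣p-q∣ p q = begin
    ℚ.∣ p ∣ ℚ.- ℚ.∣ q ∣
      ≡⟨ cong (λ r → ℚ.∣ r ∣ ℚ.- ℚ.∣ q ∣) (sym (minus-plus p q)) ⟩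
    ℚ.∣ (p ℚ.- q) ℚ.+ q ∣ ℚ.- ℚ.∣ q ∣
      ≤⟨ ℚ.+-monoˡ-≤ (ℚ.- ℚ.∣ q ∣) (ℚ.∣p+q∣≤∣p∣+∣q∣ (p ℚ.- q) q) ⟩
    (ℚ.∣ p ℚ.- q ∣ ℚ.+ ℚ.∣ q ∣) ℚ.- ℚ.∣ q ∣
      ≡⟨ plus-minus ℚ.∣ p ℚ.- q ∣ ℚ.∣ q ∣ ⟩
    ℚ.∣ p ℚ.- q ∣ ∎
    where open ℚ.≤-Reasoning

  ∣∣p∣-∣q∣∣≤∣p-q∣ : ∀ p q → ℚ.∣ ℚ.∣ p ∣ ℚ.- ℚ.∣ q ∣ ∣ ℚ.≤ ℚ.∣ p ℚ.- q ∣
  ∣∣p∣-∣q∣∣≤∣p-q∣ p q with ℚ.∣p∣≡p∨∣p∣≡-p (ℚ.∣ p ∣ ℚ.- ℚ.∣ q ∣)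
  ... | inj₁ eq = subst (ℚ._≤ ℚ.∣ p ℚ.- q ∣) (sym eq) (∣p∣-∣q∣≤∣p-q∣ p q)
  ... | inj₂ eq = begin
    ℚ.∣ ℚ.∣ p ∣ ℚ.- ℚ.∣ q ∣ ∣  ≡⟨ eq ⟩
    ℚ.- (ℚ.∣ p ∣ ℚ.- ℚ.∣ q ∣)  ≡⟨ neg-swap ℚ.∣ p ∣ ℚ.∣ q ∣ ⟩
    ℚ.∣ q ∣ ℚ.- ℚ.∣ p ∣        ≤⟨ ∣p∣-∣q∣≤∣p-q∣ q p ⟩
    ℚ.∣ q ℚ.- p ∣              ≡⟨ cong ℚ.∣_∣ (sym (neg-swap p q)) ⟩
    ℚ.∣ ℚ.- (p ℚ.- q) ∣        ≡⟨ ℚ.∣-p∣≡∣p∣ (p ℚ.- q) ⟩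
    ℚ.∣ p ℚ.- q ∣              ∎
    where open ℚ.≤-Reasoning

infixl 6 _+_ _-_
infix  8 -_
infix  4 _≤_

fromℚ : ℚ → ℝ
fromℚ q = mkℝ (λ _ → q) λ ε ε>0 → 0 , λ _ _ _ _ →
  subst (λ r → ℚ.∣ r ∣ ℚ.≤ ε) (sym (ℚ.+-inverseʳ q)) (ℚ.<⇒≤ ε>0)

0ℝ : ℝ
0ℝ = fromℚ 0ℚ

_+_ : ℝ → ℝ → ℝ
x + y = mkℝ (λ n → seq x n ℚ.+ seq y n) λ ε ε>0 →
  let M , p = cauchy x (½ ℚ.* ε) (half>0 ε>0)
      N , q = cauchy y (½ ℚ.* ε) (half>0 ε>0)
  in M ℕ.⊔ N , λ m n m≥ n≥ → let open ℚ.≤-Reasoning in begin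
    ℚ.∣ (seq x m ℚ.+ seq y m) ℚ.- (seq x n ℚ.+ seq y n) ∣
      ≡⟨ cong ℚ.∣_∣ (interchange (seq x m) (seq y m) (seq x n) (seq y n)) ⟩
    ℚ.∣ (seq x m ℚ.- seq x n) ℚ.+ (seq y m ℚ.- seq y n) ∣
      ≤⟨ ℚ.∣p+q∣≤∣p∣+∣q∣ (seq x m ℚ.- seq x n) (seq y m ℚ.- seq y n) ⟩
    ℚ.∣ seq x m ℚ.- seq x n ∣ ℚ.+ ℚ.∣ seq y m ℚ.- seq y n ∣
      ≤⟨ ℚ.+-mono-≤
           (p m n (ℕ.m⊔n≤o⇒m≤o M N m≥) (ℕ.m⊔n≤o⇒m≤o M N n≥))
           (q m n (ℕ.m⊔n≤o⇒n≤o M N m≥) (ℕ.m⊔n≤o⇒n≤o M N n≥)) ⟩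
    ½ ℚ.* ε ℚ.+ ½ ℚ.* ε
      ≡⟨ half+half ε ⟩
    ε ∎

-_ : ℝ → ℝ
- x = mkℝ (λ n → ℚ.- seq x n) λ ε ε>0 →
  let N , p = cauchy x ε ε>0
  in N , λ m n m≥ n≥ → let open ℚ.≤-Reasoning in begin
    ℚ.∣ (ℚ.- seq x m) ℚ.- (ℚ.- seq x n) ∣
      ≡⟨ cong ℚ.∣_∣ (neg-minus (seq x m) (seq x n)) ⟩
    ℚ.∣ ℚ.- (seq x m ℚ.- seq x n) ∣
      ≡⟨ ℚ.∣-p∣≡∣p∣ (seq x m ℚ.- seq x n) ⟩
    ℚ.∣ seq x m ℚ.- seq x n ∣
      ≤⟨ p m n m≥ n≥ ⟩
    ε ∎

_-_ : ℝ → ℝ → ℝ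
x - y = x + - y

∣_∣ : ℝ → ℝ
∣ x ∣ = mkℝ (λ n → ℚ.∣ seq x n ∣) λ ε ε>0 →
  let N , p = cauchy x ε ε>0
  in N , λ m n m≥ n≥ →
       ℚ.≤-trans (∣∣p∣-∣q∣∣≤∣p-q∣ (seq x m) (seq x n)) (p m n m≥ n≥)

_≤_ : ℝ → ℝ → Set
x ≤ y = ∀ ε → 0ℚ ℚ.< ε → ∃ λ N → ∀ n → N ℕ.≤ n → seq x n ℚ.≤ seq y n ℚ.+ ε

_⟶_ : (ℕ → ℝ) → ℝ → Set
x ⟶ l = ∀ ε → 0ℚ ℚ.< ε → ∃ λ N → ∀ n → N ℕ.≤ n → ∣ x n - l ∣ ≤ fromℚ ε

Converges : (ℕ → ℝ) → Set
Converges a = ∃ λ l → partialSum _+_ 0ℝ a ⟶ l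

Diverges : (ℕ → ℝ) → Set
Diverges a = ¬ Converges a

AbsolutelyConvergent : (ℕ → ℝ) → Set
AbsolutelyConvergent a = Converges (λ n → ∣ a n ∣)

ConditionallyConvergent : (ℕ → ℝ) → Set
ConditionallyConvergent a = Converges a × ¬ AbsolutelyConvergent a

-- A point of the Cantor space; also a subset of ℕ, given by its
-- characteristic function.
2^ℕ : Set
2^ℕ = ℕ → Bool

-- The subseries Σ_{n ∈ A} aₙ, in increasing order of indices.  The terms
-- outside A are replaced by 0, which only repeats partial sums; in particular
-- a finite A gives an eventually constant sequence of partial sums.
_↾_ : (ℕ → ℝ) → 2^ℕ → (ℕ → ℝ)
(a ↾ A) n = if A n then a n else 0ℝ

-- The basic clopen set of all sequences extending a finite word.
[_] : List Bool → Pred 2^ℕ 0ℓ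
[ σ ] s = ∀ (i : Fin (length σ)) → s (toℕ i) ≡ lookup σ i

-- The product measure of [ σ ], that is (1/2)^(length σ).
measure : List Bool → ℚ
measure []      = 1ℚ
measure (_ ∷ σ) = ½ ℚ.* measure σ

-- Measure zero for the completed product measure: the outer measure, an
-- infimum over countable covers by basic clopen sets, is zero.  The measures
-- are nonnegative, so bounding all partial sums bounds the total.
Null : Pred 2^ℕ 0ℓ → Set
Null X = ∀ ε → 0ℚ ℚ.< ε → ∃ λ (C : ℕ → List Bool) →
  (∀ s → s ∈ X → ∃ λ k → s ∈ [ C k ]) ×
  (∀ n → partialSum ℚ._+_ 0ℚ (λ k → measure (C k)) n ℚ.≤ ε)

-- Cardinalities are represented by types, compared by injections.  P ι says
-- that some family indexed by ι is of the kind considered; repetitions in a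
-- family do not affect the least cardinality.
IsLeastCardinality : ∀ {ℓ} → (Set → Set ℓ) → Set → Set (Level.suc 0ℓ ⊔ ℓ)
IsLeastCardinality P κ = P κ × (∀ ι → P ι → κ ↣ ι)

NullCover : Set → Set₁
NullCover ι = ∃ λ (X : ι → Pred 2^ℕ 0ℓ) →
  (∀ i → Null (X i)) × (∀ s → ∃ λ i → s ∈ X i)

SubseriesFamily : Set → Set
SubseriesFamily ι = ∃ λ (A : ι → 2^ℕ) →
  ∀ a → ConditionallyConvergent a → ∃ λ i → Diverges (a ↾ A i)

IsCov𝓛 : Set → Set₁
IsCov𝓛 = IsLeastCardinality NullCover

IsSubseriesNumber : Set → Set₁
IsSubseriesNumber = IsLeastCardinality SubseriesFamily

{-# OPTIONS --safe #-}
module Submission where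

-- Attach random signs s to a fixed series whose terms tend to 0 and have an
-- infinite sum.  For a fixed A, the subseries over A converges for almost all
-- s (Rademacher), so a family of sets A that witnesses the subseries number
-- gives null sets covering 2^ℕ once the null set belonging to A = ℕ is added to
-- each of them: a sequence s in none of them would make the signed series
-- conditionally convergent with all its subseries from the family convergent.
--
-- Almost sure convergence is obtained from a supermartingale.  The terms are
-- weight j * step j with square summable steps and weights decreasing to 0.
-- The square of the signed sum of steps, plus the variance still to come, is a
-- nonnegative supermartingale, hence bounded along almost all s; and where the
-- signed sums of steps are bounded, Dirichlet's test makes the subseries
-- converge.

open import Defs
open import Axiom.ExcludedMiddle using (ExcludedMiddle)
open import Function.Bundles using (_↣_)

open import Data.Bool using (Bool; true; false; if_then_else_; not; _∧_)
import Data.Integer as ℤ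
import Data.Integer.Properties as ℤ
open import Data.List using (List; []; _∷_; _∷ʳ_; length; replicate; applyUpTo)
open import Data.List.Properties using (length-applyUpTo; lookup-applyUpTo; applyUpTo-∷ʳ; length-replicate; length-++)
open import Data.Nat as ℕ using (ℕ; zero; suc)
import Data.Nat.Properties as ℕ
open import Data.Product using (∃; _×_; _,_; proj₁; proj₂)
open import Data.Rational as ℚ using (ℚ; 0ℚ; 1ℚ; ½)
import Data.Rational.Properties as ℚ
import Data.Rational.Unnormalised as ℚᵘ
import Data.Rational.Unnormalised.Properties as ℚᵘ
open import Data.Rational.Solver using (module +-*-Solver)
open import Data.Sum using (inj₁; inj₂)
open import Function using (_∘_)
open import Level using (0ℓ)
open import Relation.Binary.PropositionalEquality hiding ([_])
open import Relation.Nullary using (¬_; Dec; yes; no; does; contradiction)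
open import Relation.Nullary.Decidable using (dec-true; dec-false; from-yes; from-no; decidable-stable)
open import Relation.Unary using (Pred; _∈_)

open import Algebra.Definitions.RawSemiring ℚ.+-*-rawSemiring using (_^_) renaming (_×_ to _·_)
open +-*-Solver using (solve; con; _:=_; _:+_; _:*_; _:-_; :-_)

⅔ ¾ three nine : ℚ
⅔ = ℤ.+ 2 ℚ./ 3
¾ = ℤ.+ 3 ℚ./ 4
three = ℤ.+ 3 ℚ./ 1
nine = ℤ.+ 9 ℚ./ 1

-- Ordered field arithmetic

≤-by : ∀ {p q} e → 0ℚ ℚ.≤ e → q ≡ p ℚ.+ e → p ℚ.≤ q
≤-by {p} {q} e e≥0 eq = begin
  p          ≡⟨ sym (ℚ.+-identityʳ p) ⟩
  p ℚ.+ 0ℚ   ≤⟨ ℚ.+-monoʳ-≤ p e≥0 ⟩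
  p ℚ.+ e    ≡⟨ sym eq ⟩
  q          ∎
  where open ℚ.≤-Reasoning

p≤q⇒0≤q-p : ∀ {p q} → p ℚ.≤ q → 0ℚ ℚ.≤ q ℚ.- p
p≤q⇒0≤q-p {p} {q} p≤q =
  subst (ℚ._≤ q ℚ.- p) (ℚ.+-inverseʳ p) (ℚ.+-monoˡ-≤ (ℚ.- p) p≤q)

+-nonNeg : ∀ {p q} → 0ℚ ℚ.≤ p → 0ℚ ℚ.≤ q → 0ℚ ℚ.≤ p ℚ.+ q
+-nonNeg p≥0 q≥0 = ℚ.+-mono-≤ p≥0 q≥0

*-monoʳ : ∀ {p q r} → 0ℚ ℚ.≤ r → p ℚ.≤ q → r ℚ.* p ℚ.≤ r ℚ.* q
*-monoʳ {r = r} r≥0 = ℚ.*-monoˡ-≤-nonNeg r {{ℚ.nonNegative r≥0}}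

*-monoˡ : ∀ {p q r} → 0ℚ ℚ.≤ r → p ℚ.≤ q → p ℚ.* r ℚ.≤ q ℚ.* r
*-monoˡ {r = r} r≥0 = ℚ.*-monoʳ-≤-nonNeg r {{ℚ.nonNegative r≥0}}

*-nonNeg : ∀ {p q} → 0ℚ ℚ.≤ p → 0ℚ ℚ.≤ q → 0ℚ ℚ.≤ p ℚ.* q
*-nonNeg {p} {q} p≥0 q≥0 = subst (ℚ._≤ p ℚ.* q) (ℚ.*-zeroʳ p) (*-monoʳ p≥0 q≥0)

^-nonNeg : ∀ {r} n → 0ℚ ℚ.≤ r → 0ℚ ℚ.≤ r ^ n
^-nonNeg zero    r≥0 = from-yes (0ℚ ℚ.≤? 1ℚ)
^-nonNeg (suc n) r≥0 = *-nonNeg r≥0 (^-nonNeg n r≥0)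

square-nonNeg : ∀ p → 0ℚ ℚ.≤ p ℚ.* p
square-nonNeg p with ℚ.≤-total 0ℚ p
... | inj₁ p≥0 = *-nonNeg p≥0 p≥0
... | inj₂ p≤0 = subst (0ℚ ℚ.≤_)
  (solve 1 (λ p → (:- p) :* (:- p) := p :* p) refl p)
  (*-nonNeg (ℚ.neg-antimono-≤ p≤0) (ℚ.neg-antimono-≤ p≤0))

∣p∣≤q : ∀ {p q} → p ℚ.≤ q → ℚ.- p ℚ.≤ q → ℚ.∣ p ∣ ℚ.≤ q
∣p∣≤q {p} {q} p≤q -p≤q with ℚ.∣p∣≡p∨∣p∣≡-p p
... | inj₁ eq = subst (ℚ._≤ q) (sym eq) p≤q
... | inj₂ eq = subst (ℚ._≤ q) (sym eq) -p≤q

-- Completing the square leaves `(½ ∓ p)² + ¾`. This bounds a sum by its square without taking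
-- roots.
∣p∣≤1+p² : ∀ p → ℚ.∣ p ∣ ℚ.≤ 1ℚ ℚ.+ p ℚ.* p
∣p∣≤1+p² p = ∣p∣≤q
  (≤-by _ (+-nonNeg (square-nonNeg (½ ℚ.- p)) ¾≥0)
    (solve 1 (λ p → con 1ℚ :+ p :* p := p :+ ((con ½ :- p) :* (con ½ :- p) :+ con ¾)) refl p))
  (≤-by _ (+-nonNeg (square-nonNeg (½ ℚ.+ p)) ¾≥0)
    (solve 1 (λ p → con 1ℚ :+ p :* p := (:- p) :+ ((con ½ :+ p) :* (con ½ :+ p) :+ con ¾)) refl p))
  where
  ¾≥0 : 0ℚ ℚ.≤ ¾
  ¾≥0 = from-yes (0ℚ ℚ.≤? ¾)

∣p-r∣≤∣p-q∣+∣r-q∣ : ∀ p q r → ℚ.∣ p ℚ.- r ∣ ℚ.≤ ℚ.∣ p ℚ.- q ∣ ℚ.+ ℚ.∣ r ℚ.- q ∣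
∣p-r∣≤∣p-q∣+∣r-q∣ p q r = subst (λ t → ℚ.∣ t ∣ ℚ.≤ ℚ.∣ p ℚ.- q ∣ ℚ.+ ℚ.∣ r ℚ.- q ∣)
  (solve 3 (λ p q r → (p :- q) :- (r :- q) := p :- r) refl p q r)
  (ℚ.∣p-q∣≤∣p∣+∣q∣ (p ℚ.- q) (r ℚ.- q))

half-pos : ∀ {ε} → 0ℚ ℚ.< ε → 0ℚ ℚ.< ½ ℚ.* ε
half-pos {ε} ε>0 = subst (ℚ._< ½ ℚ.* ε) (ℚ.*-zeroʳ ½) (ℚ.*-monoʳ-<-pos ½ ε>0)

-- Archimedean property and geometric decay

division : ∀ x {ε} → 0ℚ ℚ.< ε → ∃ λ y → y ℚ.* ε ≡ x
division x {ε} ε>0 = x ℚ.* ε⁻¹ , (begin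
  x ℚ.* ε⁻¹ ℚ.* ε    ≡⟨ ℚ.*-assoc x ε⁻¹ ε ⟩
  x ℚ.* (ε⁻¹ ℚ.* ε)  ≡⟨ cong (x ℚ.*_) (ℚ.*-inverseˡ ε {{nz}}) ⟩
  x ℚ.* 1ℚ           ≡⟨ ℚ.*-identityʳ x ⟩
  x                  ∎)
  where
  open ≡-Reasoning
  nz = ℚ.pos⇒nonZero ε {{ℚ.positive ε>0}}
  ε⁻¹ = ℚ.1/_ ε {{nz}}

toℚᵘ-·1 : ∀ n → ℚ.toℚᵘ (n · 1ℚ) ℚᵘ.≃ ℚᵘ.mkℚᵘ (ℤ.+ n) 0
toℚᵘ-·1 zero    = ℚᵘ.≃-refl
toℚᵘ-·1 (suc n) =
  ℚᵘ.≃-trans (ℚ.toℚᵘ-homo-+ 1ℚ (n · 1ℚ))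
    (ℚᵘ.≃-trans (ℚᵘ.+-congʳ (ℚ.toℚᵘ 1ℚ) (toℚᵘ-·1 n))
      (ℚᵘ.*≡* (cong (λ k → (ℤ.+ 1 ℤ.+ k) ℤ.* ℤ.+ 1) (ℤ.*-identityʳ (ℤ.+ n)))))

archimedean : ∀ x → ∃ λ n → x ℚ.≤ n · 1ℚ
archimedean x@(ℚ.mkℚ num d-1 _) = ℤ.∣ num ∣ , ℚ.toℚᵘ-cancel-≤
  (ℚᵘ.≤-respʳ-≃ (ℚᵘ.≃-sym (toℚᵘ-·1 ℤ.∣ num ∣)) (ℚᵘ.*≤* (begin
    num ℤ.* ℤ.+ 1                  ≡⟨ ℤ.*-identityʳ num ⟩
    num                            ≤⟨ i≤∣i∣ num ⟩
    ℤ.+ ℤ.∣ num ∣                  ≤⟨ ℤ.+≤+ (ℕ.m≤m*n ℤ.∣ num ∣ (suc d-1)) ⟩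
    ℤ.+ (ℤ.∣ num ∣ ℕ.* suc d-1)    ≡⟨ ℤ.pos-* ℤ.∣ num ∣ (suc d-1) ⟩
    ℤ.+ ℤ.∣ num ∣ ℤ.* ℤ.+ suc d-1  ∎)))
  where
  open ℤ.≤-Reasoning
  i≤∣i∣ : ∀ i → i ℤ.≤ ℤ.+ ℤ.∣ i ∣
  i≤∣i∣ (ℤ.+ n)      = ℤ.≤-refl
  i≤∣i∣ ℤ.-[1+ n ]   = ℤ.-≤+

·-nonNeg : ∀ n → 0ℚ ℚ.≤ n · 1ℚ
·-nonNeg zero    = ℚ.≤-refl
·-nonNeg (suc n) = +-nonNeg (from-yes (0ℚ ℚ.≤? 1ℚ)) (·-nonNeg n)

-- Since `¾ (4 + n) = 3 + ¾ n ≤ 3 + n`, one more factor `r ≤ ¾` absorbs the growth of `3 + n`.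
^-decay : ∀ {r} → 0ℚ ℚ.≤ r → r ℚ.≤ ¾ → ∀ n → r ^ n ℚ.* (three ℚ.+ n · 1ℚ) ℚ.≤ three
^-decay r≥0 r≤¾ zero    = ℚ.≤-refl
^-decay {r} r≥0 r≤¾ (suc n) = begin
  r ℚ.* R ℚ.* (three ℚ.+ (1ℚ ℚ.+ N))
    ≡⟨ solve 3 (λ r R N → r :* R :* (con three :+ (con 1ℚ :+ N)) := r :* (R :* (con three :+ (con 1ℚ :+ N)))) refl r R N ⟩
  r ℚ.* (R ℚ.* (three ℚ.+ (1ℚ ℚ.+ N)))
    ≤⟨ *-monoˡ (*-nonNeg R≥0 (+-nonNeg 0≤3 (·-nonNeg (suc n)))) r≤¾ ⟩
  ¾ ℚ.* (R ℚ.* (three ℚ.+ (1ℚ ℚ.+ N)))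
    ≤⟨ ≤-by _ (*-nonNeg (*-nonNeg (from-yes (0ℚ ℚ.≤? ¼)) R≥0) (·-nonNeg n))
         (solve 2 (λ R N → R :* (con three :+ N) :=
           con ¾ :* (R :* (con three :+ (con 1ℚ :+ N))) :+ con ¼ :* R :* N) refl R N) ⟩
  R ℚ.* (three ℚ.+ N)
    ≤⟨ ^-decay r≥0 r≤¾ n ⟩
  three ∎
  where
  open ℚ.≤-Reasoning
  ¼ = ℤ.+ 1 ℚ./ 4
  R = r ^ n
  N = n · 1ℚ
  R≥0 = ^-nonNeg n r≥0
  0≤3 = from-yes (0ℚ ℚ.≤? three)

^-vanishes : ∀ {r} → 0ℚ ℚ.≤ r → r ℚ.≤ ¾ → ∀ {B ε} → 0ℚ ℚ.≤ B → 0ℚ ℚ.< ε → ∃ λ n → B ℚ.* r ^ n ℚ.≤ ε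
^-vanishes {r} r≥0 r≤¾ {B} {ε} B≥0 ε>0 with division (B ℚ.* three) ε>0
... | y , yε≡3B with archimedean y
... | n , y≤n = n , ℚ.*-cancelʳ-≤-pos (three ℚ.+ N) {{3+N>0}} (begin
  B ℚ.* r ^ n ℚ.* (three ℚ.+ N)    ≡⟨ ℚ.*-assoc B (r ^ n) (three ℚ.+ N) ⟩
  B ℚ.* (r ^ n ℚ.* (three ℚ.+ N))  ≤⟨ *-monoʳ B≥0 (^-decay r≥0 r≤¾ n) ⟩
  B ℚ.* three                      ≡⟨ sym yε≡3B ⟩
  y ℚ.* ε                          ≤⟨ *-monoˡ ε≥0 y≤n ⟩
  N ℚ.* ε                          ≤⟨ *-monoˡ ε≥0 (≤-by {N} _ 0≤3 (ℚ.+-comm three N)) ⟩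
  (three ℚ.+ N) ℚ.* ε              ≡⟨ ℚ.*-comm (three ℚ.+ N) ε ⟩
  ε ℚ.* (three ℚ.+ N)              ∎)
  where
  open ℚ.≤-Reasoning
  N = n · 1ℚ
  ε≥0 = ℚ.<⇒≤ ε>0
  0≤3 = from-yes (0ℚ ℚ.≤? three)
  3+N>0 = ℚ.pos+nonNeg⇒pos three N {{ℚ.nonNegative (·-nonNeg n)}}

-- Finite sums

∑ : (ℕ → ℚ) → ℕ → ℚ
∑ = partialSum ℚ._+_ 0ℚ

∑-cong : ∀ {f g} → (∀ n → f n ≡ g n) → ∀ n → ∑ f n ≡ ∑ g n
∑-cong f≗g zero    = refl
∑-cong f≗g (suc n) = cong₂ ℚ._+_ (∑-cong f≗g n) (f≗g n)

∑-mono-≤ : ∀ {f g} → (∀ n → f n ℚ.≤ g n) → ∀ n → ∑ f n ℚ.≤ ∑ g n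
∑-mono-≤ f≤g zero    = ℚ.≤-refl
∑-mono-≤ f≤g (suc n) = ℚ.+-mono-≤ (∑-mono-≤ f≤g n) (f≤g n)

∑-distrib-+ : ∀ f g n → ∑ (λ j → f j ℚ.+ g j) n ≡ ∑ f n ℚ.+ ∑ g n
∑-distrib-+ f g zero    = refl
∑-distrib-+ f g (suc n) = trans (cong (ℚ._+ (f n ℚ.+ g n)) (∑-distrib-+ f g n))
  (solve 4 (λ a b c d → (a :+ b) :+ (c :+ d) := (a :+ c) :+ (b :+ d)) refl (∑ f n) (∑ g n) (f n) (g n))

∑-distribˡ-* : ∀ c f n → ∑ (λ j → c ℚ.* f j) n ≡ c ℚ.* ∑ f n
∑-distribˡ-* c f zero    = sym (ℚ.*-zeroʳ c)
∑-distribˡ-* c f (suc n) = trans (cong (ℚ._+ c ℚ.* f n) (∑-distribˡ-* c f n))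
  (sym (ℚ.*-distribˡ-+ c (∑ f n) (f n)))

∑-zero : ∀ n → ∑ (λ _ → 0ℚ) n ≡ 0ℚ
∑-zero zero    = refl
∑-zero (suc n) = cong (ℚ._+ 0ℚ) (∑-zero n)

∑-monotone : ∀ {f} → (∀ n → 0ℚ ℚ.≤ f n) → ∀ {m n} → m ℕ.≤ n → ∑ f m ℚ.≤ ∑ f n
∑-monotone {f} f≥0 {m} m≤n = go (ℕ.≤⇒≤′ m≤n)
  where
  go : ∀ {n} → m ℕ.≤′ n → ∑ f m ℚ.≤ ∑ f n
  go ℕ.≤′-refl     = ℚ.≤-refl
  go (ℕ.≤′-step p) = ℚ.≤-trans (go p) (≤-by _ (f≥0 _) refl)

-- The indices `2j + 1` and `2j + 2` are the children of `j` in a binary heap; the first `2n + 1`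
-- indices are the root and the children of all `j < n`.
∑-pairs : ∀ f n → ∑ f (suc (n ℕ.* 2)) ≡ f 0 ℚ.+ ∑ (λ j → f (suc (j ℕ.* 2)) ℚ.+ f (suc (suc (j ℕ.* 2)))) n
∑-pairs f zero    = ℚ.+-comm 0ℚ (f 0)
∑-pairs f (suc n) = trans (cong (λ t → t ℚ.+ a ℚ.+ b) (∑-pairs f n))
  (solve 4 (λ x y a b → x :+ y :+ a :+ b := x :+ (y :+ (a :+ b))) refl (f 0) _ a b)
  where
  a = f (suc (n ℕ.* 2))
  b = f (suc (suc (n ℕ.* 2)))

-- The step overshoots to `2n + 1 ≥ n + 1`, and downward closure returns to `n + 1`. Upper bounds on
-- partial sums of nonnegative terms are downward closed.
heap-induction : (P : ℕ → Set) → P 0 → (∀ {m n} → m ℕ.≤ n → P n → P m) →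
                 (∀ n → P n → P (suc (n ℕ.* 2))) → ∀ n → P n
heap-induction P base down step zero    = base
heap-induction P base down step (suc n) =
  down (ℕ.s≤s (ℕ.m≤m*n n 2)) (step n (heap-induction P base down step n))

-- The enumeration of all words in heap order

-- Increment in bijective base 2, least significant digit first.
next : List Bool → List Bool
next []          = false ∷ []
next (false ∷ σ) = true ∷ σ
next (true ∷ σ)  = false ∷ next σ

word : ℕ → List Bool
word zero    = []
word (suc n) = next (word n)

-- Two increments lead from `false ∷ σ` through `true ∷ σ` to `false ∷ next σ`, so they increment
-- the tail once.
word-odd : ∀ n → word (suc (n ℕ.* 2)) ≡ false ∷ word n
word-odd zero    = refl
word-odd (suc n) = cong (next ∘ next) (word-odd n)

word-even : ∀ n → word (suc (suc (n ℕ.* 2))) ≡ true ∷ word n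
word-even n = cong next (word-odd n)

word-surjective : ∀ σ → ∃ λ n → word n ≡ σ
word-surjective [] = 0 , refl
word-surjective (false ∷ σ) with word-surjective σ
... | n , eq = suc (n ℕ.* 2) , trans (word-odd n) (cong (false ∷_) eq)
word-surjective (true ∷ σ) with word-surjective σ
... | n , eq = suc (suc (n ℕ.* 2)) , trans (word-even n) (cong (true ∷_) eq)

∑-words : ∀ (g : List Bool → ℚ) n → ∑ (g ∘ word) (suc (n ℕ.* 2)) ≡
          g [] ℚ.+ ∑ (λ j → g (false ∷ word j) ℚ.+ g (true ∷ word j)) n
∑-words g n = trans (∑-pairs (g ∘ word) n)
  (cong (g [] ℚ.+_) (∑-cong (λ j → cong₂ ℚ._+_ (cong g (word-odd j)) (cong g (word-even j))) n))

measure≡½^length : ∀ σ → measure σ ≡ ½ ^ length σ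
measure≡½^length []      = refl
measure≡½^length (_ ∷ σ) = cong (½ ℚ.*_) (measure≡½^length σ)

measure-nonNeg : ∀ σ → 0ℚ ℚ.≤ measure σ
measure-nonNeg σ = subst (0ℚ ℚ.≤_) (sym (measure≡½^length σ))
  (^-nonNeg (length σ) (from-yes (0ℚ ℚ.≤? ½)))

-- Supermartingales

-- In `fair`, the mean over the two one-letter extensions is compared with the current value, both
-- doubled to avoid a division.
record Supermartingale (D : List Bool → ℚ) : Set where
  field
    nonNeg : ∀ σ → 0ℚ ℚ.≤ D σ
    fair   : ∀ σ → D (σ ∷ʳ false) ℚ.+ D (σ ∷ʳ true) ℚ.≤ D σ ℚ.+ D σ

open Supermartingale

shift : ∀ {D} b → Supermartingale D → Supermartingale (D ∘ (b ∷_))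
shift b sm .nonNeg σ = sm .nonNeg (b ∷ σ)
shift b sm .fair σ   = sm .fair (b ∷ σ)

+-supermartingale : ∀ {D E} → Supermartingale D → Supermartingale E →
                    Supermartingale (λ σ → D σ ℚ.+ E σ)
+-supermartingale d e .nonNeg σ = +-nonNeg (d .nonNeg σ) (e .nonNeg σ)
+-supermartingale {D} {E} d e .fair σ = subst₂ ℚ._≤_
  (interchange (D (σ ∷ʳ false)) (D (σ ∷ʳ true)) (E (σ ∷ʳ false)) (E (σ ∷ʳ true)))
  (interchange (D σ) (D σ) (E σ) (E σ))
  (ℚ.+-mono-≤ (d .fair σ) (e .fair σ))
  where
  interchange : ∀ a b c d → (a ℚ.+ b) ℚ.+ (c ℚ.+ d) ≡ (a ℚ.+ c) ℚ.+ (b ℚ.+ d)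
  interchange = solve 4 (λ a b c d → (a :+ b) :+ (c :+ d) := (a :+ c) :+ (b :+ d)) refl

-- First passage and the maximal inequality

-- A word is rejected if a proper prefix already reaches `M`, so the accepted words form an
-- antichain and their cylinders are disjoint.
hits : ℚ → (List Bool → ℚ) → List Bool → Bool
hits M D []      = does (M ℚ.≤? D [])
hits M D (b ∷ σ) = not (does (M ℚ.≤? D [])) ∧ hits M (D ∘ (b ∷_)) σ

hitMass : ℚ → (List Bool → ℚ) → List Bool → ℚ
hitMass M D σ = if hits M D σ then measure σ else 0ℚ

hits-prefix : ∀ {M} D s n → M ℚ.≤ D (applyUpTo s n) → ∃ λ m → hits M D (applyUpTo s m) ≡ true
hits-prefix {M} D s n M≤ with M ℚ.≤? D []
... | yes p = 0 , dec-true (M ℚ.≤? D []) p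
hits-prefix D s zero    M≤ | no ¬p = contradiction M≤ ¬p
hits-prefix {M} D s (suc n) M≤ | no ¬p with hits-prefix (D ∘ (s 0 ∷_)) (s ∘ suc) n M≤
... | m , h = suc m , cong₂ (λ x y → not x ∧ y) (dec-false (M ℚ.≤? D []) ¬p) h

hitMass-nonNeg : ∀ M D σ → 0ℚ ℚ.≤ hitMass M D σ
hitMass-nonNeg M D σ with hits M D σ
... | true  = measure-nonNeg σ
... | false = ℚ.≤-refl

hitMass-∷-stopped : ∀ {M} D → M ℚ.≤ D [] → ∀ b σ → hitMass M D (b ∷ σ) ≡ 0ℚ
hitMass-∷-stopped {M} D p b σ rewrite dec-true (M ℚ.≤? D []) p = refl

hitMass-∷-running : ∀ {M} D → ¬ M ℚ.≤ D [] → ∀ b σ →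
                    hitMass M D (b ∷ σ) ≡ ½ ℚ.* hitMass M (D ∘ (b ∷_)) σ
hitMass-∷-running {M} D ¬p b σ rewrite dec-false (M ℚ.≤? D []) ¬p with hits M (D ∘ (b ∷_)) σ
... | true  = refl
... | false = refl

hitMass-[]-stopped : ∀ {M} D → M ℚ.≤ D [] → hitMass M D [] ≡ 1ℚ
hitMass-[]-stopped {M} D p rewrite dec-true (M ℚ.≤? D []) p = refl

hitMass-[]-running : ∀ {M} D → ¬ M ℚ.≤ D [] → hitMass M D [] ≡ 0ℚ
hitMass-[]-running {M} D ¬p rewrite dec-false (M ℚ.≤? D []) ¬p = refl

-- Ville's maximal inequality; hitMass M D restricts the measure to the words at
-- which D first reaches M.
ville : ∀ {D} M → 0ℚ ℚ.≤ M → Supermartingale D → ∀ n → M ℚ.* ∑ (hitMass M D ∘ word) n ℚ.≤ D []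
ville M M≥0 sm n = heap-induction
  -- The claim is quantified over `D` because the step applies it to both shifts of `D`.
  (λ n → ∀ D → Supermartingale D → M ℚ.* ∑ (hitMass M D ∘ word) n ℚ.≤ D [])
  (λ D sm → subst (ℚ._≤ D []) (sym (ℚ.*-zeroʳ M)) (sm .nonNeg []))
  (λ m≤n P D sm → ℚ.≤-trans
    (*-monoʳ M≥0 (∑-monotone (λ j → hitMass-nonNeg M D (word j)) m≤n)) (P D sm))
  step n _ sm
  where
  open ℚ.≤-Reasoning
  step : ∀ n → (∀ D → Supermartingale D → M ℚ.* ∑ (hitMass M D ∘ word) n ℚ.≤ D []) →
         ∀ D → Supermartingale D → M ℚ.* ∑ (hitMass M D ∘ word) (suc (n ℕ.* 2)) ℚ.≤ D []
  step n P D sm with M ℚ.≤? D []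
  -- Passage at the root: the empty word carries mass 1 and every longer word carries 0.
  ... | yes p = begin
    M ℚ.* ∑ (hitMass M D ∘ word) (suc (n ℕ.* 2))
      ≡⟨ cong (M ℚ.*_) (∑-words (hitMass M D) n) ⟩
    M ℚ.* (hitMass M D [] ℚ.+ ∑ (λ j → hitMass M D (false ∷ word j) ℚ.+ hitMass M D (true ∷ word j)) n)
      ≡⟨ cong (M ℚ.*_) (cong₂ ℚ._+_ (hitMass-[]-stopped D p) (trans
           (∑-cong (λ j → cong₂ ℚ._+_ (hitMass-∷-stopped D p false (word j)) (hitMass-∷-stopped D p true (word j))) n)
           (∑-zero n))) ⟩
    M ℚ.* 1ℚ
      ≡⟨ ℚ.*-identityʳ M ⟩
    M
      ≤⟨ p ⟩
    D [] ∎
  -- No passage at the root: each of the two subtrees contributes half the mass belonging to the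
  -- shifted supermartingale.
  ... | no ¬p = begin
    M ℚ.* ∑ (hitMass M D ∘ word) (suc (n ℕ.* 2))
      ≡⟨ cong (M ℚ.*_) (∑-words (hitMass M D) n) ⟩
    M ℚ.* (hitMass M D [] ℚ.+ ∑ (λ j → hitMass M D (false ∷ word j) ℚ.+ hitMass M D (true ∷ word j)) n)
      ≡⟨ cong (M ℚ.*_) (cong₂ ℚ._+_ (hitMass-[]-running D ¬p)
           (∑-cong (λ j → cong₂ ℚ._+_ (hitMass-∷-running D ¬p false (word j)) (hitMass-∷-running D ¬p true (word j))) n)) ⟩
    M ℚ.* (0ℚ ℚ.+ ∑ (λ j → ½ ℚ.* f false j ℚ.+ ½ ℚ.* f true j) n)
      ≡⟨ cong (λ t → M ℚ.* (0ℚ ℚ.+ t)) (trans (∑-distrib-+ _ _ n)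
           (cong₂ ℚ._+_ (∑-distribˡ-* ½ (f false) n) (∑-distribˡ-* ½ (f true) n))) ⟩
    M ℚ.* (0ℚ ℚ.+ (½ ℚ.* ∑ (f false) n ℚ.+ ½ ℚ.* ∑ (f true) n))
      ≡⟨ solve 3 (λ M a b → M :* (con 0ℚ :+ (con ½ :* a :+ con ½ :* b)) := con ½ :* (M :* a :+ M :* b)) refl
           M (∑ (f false) n) (∑ (f true) n) ⟩
    ½ ℚ.* (M ℚ.* ∑ (f false) n ℚ.+ M ℚ.* ∑ (f true) n)
      ≤⟨ *-monoʳ (from-yes (0ℚ ℚ.≤? ½)) (ℚ.+-mono-≤ (P _ (shift false sm)) (P _ (shift true sm))) ⟩
    ½ ℚ.* (D (false ∷ []) ℚ.+ D (true ∷ []))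
      ≤⟨ *-monoʳ (from-yes (0ℚ ℚ.≤? ½)) (sm .fair []) ⟩
    ½ ℚ.* (D [] ℚ.+ D [])
      ≡⟨ solve 1 (λ a → con ½ :* (a :+ a) := a) refl (D []) ⟩
    D [] ∎
    where
    f : Bool → ℕ → ℚ
    f b j = hitMass M (D ∘ (b ∷_)) (word j)

-- Unboundedness of a supermartingale on a null set

-- The partial sum misses `½ ^ K` by exactly `½ ^ (n + K)`.
∑-½^ : ∀ K n → ∑ (λ k → ½ ^ (suc k ℕ.+ K)) n ℚ.≤ ½ ^ K
∑-½^ K n = ≤-by _ (^-nonNeg (n ℕ.+ K) (from-yes (0ℚ ℚ.≤? ½))) (sym (telescope n))
  where
  telescope : ∀ n → ∑ (λ k → ½ ^ (suc k ℕ.+ K)) n ℚ.+ ½ ^ (n ℕ.+ K) ≡ ½ ^ K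
  telescope zero    = ℚ.+-identityˡ (½ ^ K)
  telescope (suc n) = trans
    (solve 2 (λ a x → a :+ con ½ :* x :+ con ½ :* x := a :+ x) refl
      (∑ (λ k → ½ ^ (suc k ℕ.+ K)) n) (½ ^ (n ℕ.+ K)))
    (telescope n)

UnboundedAlong : (List Bool → ℚ) → Pred 2^ℕ 0ℓ
UnboundedAlong D s = ∀ B → ∃ λ n → B ℚ.≤ D (applyUpTo s n)

applyUpTo-prefix : ∀ (s : 2^ℕ) n → s ∈ [ applyUpTo s n ]
applyUpTo-prefix s n i = sym (lookup-applyUpTo s n i)

-- A cover must list a word at every index, so the indices k whose word is not
-- a first hit get a word of measure 2^-(k+1+K) instead.
unbounded-cover : ∀ {D} → Supermartingale D → ∀ {e} M K → 0ℚ ℚ.< e → M ℚ.* e ≡ D [] ℚ.+ 1ℚ → ½ ^ K ℚ.≤ e →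
  ∃ λ (C : ℕ → List Bool) →
    (∀ s → s ∈ UnboundedAlong D → ∃ λ k → s ∈ [ C k ]) ×
    (∀ n → ∑ (measure ∘ C) n ℚ.≤ e ℚ.+ e)
unbounded-cover {D} sm {e} M K e>0 Me≡D+1 ½^K≤e = C , covers , small
  where
  -- The summand 1 in `D [] + 1` keeps `M` positive even if `D []` is 0, so the maximal inequality
  -- can be divided by `M`.
  M>0 : 0ℚ ℚ.< M
  M>0 = ℚ.*-cancelʳ-<-nonNeg e {{ℚ.nonNegative (ℚ.<⇒≤ e>0)}} (begin-strict
    0ℚ ℚ.* e     ≡⟨ ℚ.*-zeroˡ e ⟩
    0ℚ           <⟨ ℚ.+-mono-≤-< (sm .nonNeg []) (from-yes (0ℚ ℚ.<? 1ℚ)) ⟩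
    D [] ℚ.+ 1ℚ  ≡⟨ sym Me≡D+1 ⟩
    M ℚ.* e      ∎)
    where open ℚ.≤-Reasoning

  filler : ℕ → List Bool
  filler k = replicate (suc k ℕ.+ K) true

  C : ℕ → List Bool
  C k = if hits M D (word k) then word k else filler k

  covers : ∀ s → s ∈ UnboundedAlong D → ∃ λ k → s ∈ [ C k ]
  covers s unb with unb M
  ... | n , M≤ with hits-prefix D s n M≤
  ... | m , hit with word-surjective (applyUpTo s m)
  ... | k , eq = k , subst (λ σ → s ∈ [ σ ]) (sym Ck≡) (applyUpTo-prefix s m)
    where
    Ck≡ : C k ≡ applyUpTo s m
    Ck≡ rewrite eq | hit = refl

  measure-if : ∀ b σ τ → measure (if b then σ else τ) ℚ.≤ (if b then measure σ else 0ℚ) ℚ.+ measure τ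
  measure-if true  σ τ = ≤-by _ (measure-nonNeg τ) refl
  measure-if false σ τ = ℚ.≤-reflexive (sym (ℚ.+-identityˡ (measure τ)))

  measure-filler : ∀ k → measure (filler k) ≡ ½ ^ (suc k ℕ.+ K)
  measure-filler k = trans (measure≡½^length (filler k)) (cong (½ ^_) (length-replicate (suc k ℕ.+ K)))

  hitSum≤e : ∀ n → ∑ (hitMass M D ∘ word) n ℚ.≤ e
  hitSum≤e n = ℚ.*-cancelˡ-≤-pos M {{ℚ.positive M>0}} (begin
    M ℚ.* ∑ (hitMass M D ∘ word) n  ≤⟨ ville M (ℚ.<⇒≤ M>0) sm n ⟩
    D []                            ≤⟨ ≤-by _ (from-yes (0ℚ ℚ.≤? 1ℚ)) refl ⟩
    D [] ℚ.+ 1ℚ                     ≡⟨ sym Me≡D+1 ⟩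
    M ℚ.* e                         ∎)
    where open ℚ.≤-Reasoning

  small : ∀ n → ∑ (measure ∘ C) n ℚ.≤ e ℚ.+ e
  small n = begin
    ∑ (measure ∘ C) n
      ≤⟨ ∑-mono-≤ (λ k → measure-if (hits M D (word k)) (word k) (filler k)) n ⟩
    ∑ (λ k → hitMass M D (word k) ℚ.+ measure (filler k)) n
      ≡⟨ ∑-distrib-+ (hitMass M D ∘ word) (measure ∘ filler) n ⟩
    ∑ (hitMass M D ∘ word) n ℚ.+ ∑ (measure ∘ filler) n
      ≡⟨ cong (∑ (hitMass M D ∘ word) n ℚ.+_) (∑-cong measure-filler n) ⟩
    ∑ (hitMass M D ∘ word) n ℚ.+ ∑ (λ k → ½ ^ (suc k ℕ.+ K)) n
      ≤⟨ ℚ.+-mono-≤ (hitSum≤e n) (∑-½^ K n) ⟩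
    e ℚ.+ ½ ^ K
      ≤⟨ ℚ.+-monoʳ-≤ e ½^K≤e ⟩
    e ℚ.+ e ∎
    where open ℚ.≤-Reasoning

-- Half of `ε` pays for the first passage words at level `M = (D [] + 1) / (ε / 2)`, the other half
-- for the fillers.
unbounded-null : ∀ {D} → Supermartingale D → Null (UnboundedAlong D)
unbounded-null {D} sm ε ε>0 =
  let M , Me≡D+1 = division (D [] ℚ.+ 1ℚ) (half-pos ε>0)
      K , 1*½^K≤e = ½^-vanishes {1ℚ} (from-yes (0ℚ ℚ.≤? 1ℚ)) (half-pos ε>0)
      ½^K≤e = subst (ℚ._≤ ½ ℚ.* ε) (ℚ.*-identityˡ (½ ^ K)) 1*½^K≤e
      C , covers , small = unbounded-cover sm M K (half-pos ε>0) Me≡D+1 ½^K≤e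
  in C , covers , λ n → subst (∑ (measure ∘ C) n ℚ.≤_) (half+half ε) (small n)
  where
  half+half : ∀ ε → ½ ℚ.* ε ℚ.+ ½ ℚ.* ε ≡ ε
  half+half = solve 1 (λ ε → con ½ :* ε :+ con ½ :* ε := ε) refl
  ½^-vanishes : ∀ {B ε} → 0ℚ ℚ.≤ B → 0ℚ ℚ.< ε → ∃ λ n → B ℚ.* ½ ^ n ℚ.≤ ε
  ½^-vanishes = ^-vanishes (from-yes (0ℚ ℚ.≤? ½)) (from-yes (½ ℚ.≤? ¾))

-- The greedy path: it takes `true` exactly when this does not raise `D`.
descend : (List Bool → ℚ) → 2^ℕ
descend D zero    = does (D (true ∷ []) ℚ.≤? D [])
descend D (suc n) = descend (D ∘ (descend D 0 ∷_)) n

-- By fairness the two children cannot both exceed their parent, so the greedy choice never raises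
-- `D`.
descend-≤ : ∀ {D} → Supermartingale D → ∀ n → D (applyUpTo (descend D) n) ℚ.≤ D []
descend-≤ sm zero = ℚ.≤-refl
descend-≤ {D} sm (suc n) = ℚ.≤-trans (descend-≤ (shift (descend D 0) sm) n)
  (first (D (true ∷ []) ℚ.≤? D []))
  where
  first : (d : Dec (D (true ∷ []) ℚ.≤ D [])) → D (does d ∷ []) ℚ.≤ D []
  first (yes p) = p
  first (no ¬p) = ℚ.≮⇒≥ λ q → ℚ.<-irrefl refl
    (ℚ.<-≤-trans (ℚ.+-mono-< q (ℚ.≰⇒> ¬p)) (sm .fair []))

-- Random signed sums

signed : Bool → ℚ → ℚ
signed b q = if b then q else ℚ.- q

walk : (ℕ → ℚ) → List Bool → ℚ
walk f []      = 0ℚ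
walk f (b ∷ σ) = signed b (f 0) ℚ.+ walk (f ∘ suc) σ

walk-∷ʳ : ∀ f σ b → walk f (σ ∷ʳ b) ≡ walk f σ ℚ.+ signed b (f (length σ))
walk-∷ʳ f []      b = ℚ.+-comm (signed b (f 0)) 0ℚ
walk-∷ʳ f (c ∷ σ) b = trans (cong (signed c (f 0) ℚ.+_) (walk-∷ʳ (f ∘ suc) σ b))
  (sym (ℚ.+-assoc (signed c (f 0)) (walk (f ∘ suc) σ) (signed b (f (suc (length σ))))))

walk-applyUpTo : ∀ f s n → walk f (applyUpTo s n) ≡ ∑ (λ j → signed (s j) (f j)) n
walk-applyUpTo f s zero    = refl
walk-applyUpTo f s (suc n) = begin
  walk f (applyUpTo s (suc n))
    ≡⟨ cong (walk f) (sym (applyUpTo-∷ʳ s n)) ⟩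
  walk f (applyUpTo s n ∷ʳ s n)
    ≡⟨ walk-∷ʳ f (applyUpTo s n) (s n) ⟩
  walk f (applyUpTo s n) ℚ.+ signed (s n) (f (length (applyUpTo s n)))
    ≡⟨ cong₂ ℚ._+_ (walk-applyUpTo f s n) (cong (signed (s n) ∘ f) (length-applyUpTo s n)) ⟩
  ∑ (λ j → signed (s j) (f j)) (suc n) ∎
  where open ≡-Reasoning

-- Since 2^k indices j have a word of length k, the bases must satisfy
-- 2 (2/3)² < 1 for square summability and 2 (2/3) (3/4) ≥ 1 for divergence.
step weight : ℕ → ℚ
step j   = ⅔ ^ length (word j)
weight j = ¾ ^ length (word j)

-- Because `¾ · ⅔ = ½`, the series has the measures of the words as the absolute values of its
-- terms.
weight*step : ∀ j → weight j ℚ.* step j ≡ measure (word j)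
weight*step j = go (word j)
  where
  go : ∀ σ → ¾ ^ length σ ℚ.* ⅔ ^ length σ ≡ measure σ
  go []      = refl
  go (_ ∷ σ) = trans
    (solve 2 (λ a b → (con ¾ :* a) :* (con ⅔ :* b) := con ½ :* (a :* b)) refl (¾ ^ length σ) (⅔ ^ length σ))
    (cong (½ ℚ.*_) (go σ))

weight-nonNeg : ∀ j → 0ℚ ℚ.≤ weight j
weight-nonNeg j = ^-nonNeg (length (word j)) (from-yes (0ℚ ℚ.≤? ¾))

-- Incrementing never shortens a word, and `¾ ≤ 1`.
weight-antitone : ∀ j → weight (suc j) ℚ.≤ weight j
weight-antitone j = go (word j)
  where
  go : ∀ σ → ¾ ^ length (next σ) ℚ.≤ ¾ ^ length σ
  go []          = from-yes (¾ ℚ.* 1ℚ ℚ.≤? 1ℚ)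
  go (false ∷ σ) = ℚ.≤-refl
  go (true ∷ σ)  = *-monoʳ (from-yes (0ℚ ℚ.≤? ¾)) (go σ)

weight-vanishes : ∀ {B ε} → 0ℚ ℚ.≤ B → 0ℚ ℚ.< ε → ∃ λ j → B ℚ.* weight j ℚ.≤ ε
weight-vanishes {B} {ε} B≥0 ε>0 =
  let k , B¾^k≤ε = ^-vanishes (from-yes (0ℚ ℚ.≤? ¾)) ℚ.≤-refl B≥0 ε>0
      j , eq = word-surjective (replicate k true)
  in j , subst (λ l → B ℚ.* ¾ ^ l ℚ.≤ ε) (sym (trans (cong length eq) (length-replicate k))) B¾^k≤ε

-- Passing from `n` to `2n + 1` terms maps the sum `t` to `1 + 8/9 t`, where `8/9 = 2 (2/3)²`; the
-- bound 9 is the fixed point of this map.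
∑-step²≤9 : ∀ n → ∑ (λ j → step j ℚ.* step j) n ℚ.≤ nine
∑-step²≤9 = heap-induction (λ n → ∑ (g ∘ word) n ℚ.≤ nine)
  (from-yes (0ℚ ℚ.≤? nine))
  (λ m≤n → ℚ.≤-trans (∑-monotone (λ j → square-nonNeg (step j)) m≤n))
  (λ n ih → begin
    ∑ (g ∘ word) (suc (n ℕ.* 2))
      ≡⟨ ∑-words g n ⟩
    1ℚ ℚ.+ ∑ (λ j → g (false ∷ word j) ℚ.+ g (true ∷ word j)) n
      ≡⟨ cong (1ℚ ℚ.+_) (trans (∑-cong double n) (∑-distribˡ-* 8/9 (g ∘ word) n)) ⟩
    1ℚ ℚ.+ 8/9 ℚ.* ∑ (g ∘ word) n
      ≤⟨ ℚ.+-monoʳ-≤ 1ℚ (*-monoʳ (from-yes (0ℚ ℚ.≤? 8/9)) ih) ⟩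
    nine ∎)
  where
  open ℚ.≤-Reasoning
  8/9 : ℚ
  8/9 = ℤ.+ 8 ℚ./ 9
  g : List Bool → ℚ
  g σ = ⅔ ^ length σ ℚ.* ⅔ ^ length σ
  double : ∀ j → g (false ∷ word j) ℚ.+ g (true ∷ word j) ≡ 8/9 ℚ.* g (word j)
  double j = solve 1 (λ x → con ⅔ :* x :* (con ⅔ :* x) :+ con ⅔ :* x :* (con ⅔ :* x) := con 8/9 :* (x :* x)) refl
    (step j)

∑-measure-word : ∀ n → ∑ (measure ∘ word) (suc (n ℕ.* 2)) ≡ 1ℚ ℚ.+ ∑ (measure ∘ word) n
∑-measure-word n = trans (∑-words measure n) (cong (1ℚ ℚ.+_) (∑-cong
  (λ j → solve 1 (λ x → con ½ :* x :+ con ½ :* x := x) refl (measure (word j))) n))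

mask : 2^ℕ → (ℕ → ℚ) → ℕ → ℚ
mask A f n = if A n then f n else 0ℚ

-- The upper bound `nine` stands in for the total of the squared steps. Steps outside `A` are
-- charged too, so the second summand does not depend on `A`.
energy : 2^ℕ → List Bool → ℚ
energy A σ = walk (mask A step) σ ℚ.* walk (mask A step) σ ℚ.+ (nine ℚ.- ∑ (λ j → step j ℚ.* step j) (length σ))

-- The cross terms `± 2 W x` cancel between the two signs. What remains is a loss of `2 (y² - x²)`,
-- nonnegative because `x` is either `y` or 0.
energy-supermartingale : ∀ A → Supermartingale (energy A)
energy-supermartingale A .nonNeg σ =
  +-nonNeg (square-nonNeg (walk (mask A step) σ)) (p≤q⇒0≤q-p (∑-step²≤9 (length σ)))
energy-supermartingale A .fair σ = ≤-by _ (+-nonNeg gain gain) (trans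
  (identity W x y nine V)
  (cong (ℚ._+ ((y ℚ.* y ℚ.- x ℚ.* x) ℚ.+ (y ℚ.* y ℚ.- x ℚ.* x)))
    (sym (cong₂ ℚ._+_ (energy-∷ʳ false) (energy-∷ʳ true)))))
  where
  W x y V : ℚ
  W = walk (mask A step) σ
  x = mask A step (length σ)
  y = step (length σ)
  V = ∑ (λ j → step j ℚ.* step j) (length σ)
  gain : 0ℚ ℚ.≤ y ℚ.* y ℚ.- x ℚ.* x
  gain = masked (A (length σ)) y
    where
    masked : ∀ b y → 0ℚ ℚ.≤ y ℚ.* y ℚ.- (if b then y else 0ℚ) ℚ.* (if b then y else 0ℚ)
    masked true  y = ℚ.≤-reflexive (sym (ℚ.+-inverseʳ (y ℚ.* y)))
    masked false y = p≤q⇒0≤q-p (square-nonNeg y)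
  energy-∷ʳ : ∀ b → energy A (σ ∷ʳ b) ≡
    (W ℚ.+ signed b x) ℚ.* (W ℚ.+ signed b x) ℚ.+ (nine ℚ.- (V ℚ.+ y ℚ.* y))
  energy-∷ʳ b = cong₂ (λ w n → w ℚ.* w ℚ.+ (nine ℚ.- ∑ (λ j → step j ℚ.* step j) n))
    (walk-∷ʳ (mask A step) σ b) (trans (length-++ σ) (ℕ.+-comm (length σ) 1))
  identity : ∀ W x y c V →
    (W ℚ.* W ℚ.+ (c ℚ.- V)) ℚ.+ (W ℚ.* W ℚ.+ (c ℚ.- V)) ≡
    (((W ℚ.+ ℚ.- x) ℚ.* (W ℚ.+ ℚ.- x) ℚ.+ (c ℚ.- (V ℚ.+ y ℚ.* y))) ℚ.+
     ((W ℚ.+ x) ℚ.* (W ℚ.+ x) ℚ.+ (c ℚ.- (V ℚ.+ y ℚ.* y)))) ℚ.+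
    ((y ℚ.* y ℚ.- x ℚ.* x) ℚ.+ (y ℚ.* y ℚ.- x ℚ.* x))
  identity = solve 5 (λ W x y c V →
    (W :* W :+ (c :- V)) :+ (W :* W :+ (c :- V)) :=
    (((W :+ :- x) :* (W :+ :- x) :+ (c :- (V :+ y :* y))) :+
     ((W :+ x) :* (W :+ x) :+ (c :- (V :+ y :* y)))) :+
    ((y :* y :- x :* x) :+ (y :* y :- x :* x))) refl

-- Convergence of the subseries

IsCauchy : (ℕ → ℚ) → Set
IsCauchy q = ∀ ε → 0ℚ ℚ.< ε →
             ∃ λ N → ∀ m n → N ℕ.≤ m → N ℕ.≤ n → ℚ.∣ q m ℚ.- q n ∣ ℚ.≤ ε

module SummationByParts (v x : ℕ → ℚ) (v≥0 : ∀ n → 0ℚ ℚ.≤ v n) (v↓ : ∀ n → v (suc n) ℚ.≤ v n)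
                        (B : ℚ) (bounded : ∀ n → ℚ.∣ ∑ x n ∣ ℚ.≤ B) where
  open ℚ.≤-Reasoning

  -- `E` is the Abel transform of `S`: it equals the sum of `(v j - v (suc j)) * ∑ x (suc j)` over
  -- `j < n`.
  S E : ℕ → ℚ
  S = ∑ (λ j → v j ℚ.* x j)
  E n = S n ℚ.- v n ℚ.* ∑ x n

  ∣v*∑∣≤ : ∀ {w} n → 0ℚ ℚ.≤ w → ℚ.∣ w ℚ.* ∑ x n ∣ ℚ.≤ w ℚ.* B
  ∣v*∑∣≤ {w} n w≥0 = begin
    ℚ.∣ w ℚ.* ∑ x n ∣          ≡⟨ ℚ.∣p*q∣≡∣p∣*∣q∣ w (∑ x n) ⟩
    ℚ.∣ w ∣ ℚ.* ℚ.∣ ∑ x n ∣    ≡⟨ cong (ℚ._* ℚ.∣ ∑ x n ∣) (ℚ.0≤p⇒∣p∣≡p w≥0) ⟩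
    w ℚ.* ℚ.∣ ∑ x n ∣          ≤⟨ *-monoʳ w≥0 (bounded n) ⟩
    w ℚ.* B                    ∎

  -- Each increment of `E` is at most a decrement of `v` times `B`, and the decrements telescope.
  E-variation : ∀ m k → ℚ.∣ E (k ℕ.+ m) ℚ.- E m ∣ ℚ.≤ (v m ℚ.- v (k ℕ.+ m)) ℚ.* B
  E-variation m zero = ℚ.≤-reflexive (trans (cong ℚ.∣_∣ (ℚ.+-inverseʳ (E m)))
    (solve 2 (λ w b → con 0ℚ := (w :- w) :* b) refl (v m) B))
  E-variation m (suc k) = begin
    ℚ.∣ E (suc n) ℚ.- E m ∣
      ≡⟨ cong ℚ.∣_∣ (solve 6 (λ s w w′ l y e →
           (s :+ w :* y :- w′ :* (l :+ y)) :- e := (s :- w :* l :- e) :+ (w :- w′) :* (l :+ y)) refl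
           (S n) (v n) (v (suc n)) (∑ x n) (x n) (E m)) ⟩
    ℚ.∣ (E n ℚ.- E m) ℚ.+ (v n ℚ.- v (suc n)) ℚ.* ∑ x (suc n) ∣
      ≤⟨ ℚ.∣p+q∣≤∣p∣+∣q∣ (E n ℚ.- E m) _ ⟩
    ℚ.∣ E n ℚ.- E m ∣ ℚ.+ ℚ.∣ (v n ℚ.- v (suc n)) ℚ.* ∑ x (suc n) ∣
      ≤⟨ ℚ.+-mono-≤ (E-variation m k) (∣v*∑∣≤ (suc n) (p≤q⇒0≤q-p (v↓ n))) ⟩
    (v m ℚ.- v n) ℚ.* B ℚ.+ (v n ℚ.- v (suc n)) ℚ.* B
      ≡⟨ solve 4 (λ a b c d → (a :- b) :* d :+ (b :- c) :* d := (a :- c) :* d) refl (v m) (v n) (v (suc n)) B ⟩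
    (v m ℚ.- v (suc n)) ℚ.* B ∎
    where n = k ℕ.+ m

  -- The boundary terms add `v n * B + v m * B` to the bound for `E`; `v n` cancels, which leaves a
  -- bound depending on `m` alone.
  S-variation : ∀ m {n} → m ℕ.≤ n → ℚ.∣ S n ℚ.- S m ∣ ℚ.≤ v m ℚ.* B ℚ.+ v m ℚ.* B
  S-variation m {n} m≤n = begin
    ℚ.∣ S n ℚ.- S m ∣
      ≡⟨ cong ℚ.∣_∣ (solve 4 (λ s a t b → s :- t := ((s :- a) :- (t :- b)) :+ (a :- b)) refl
           (S n) (v n ℚ.* ∑ x n) (S m) (v m ℚ.* ∑ x m)) ⟩
    ℚ.∣ (E n ℚ.- E m) ℚ.+ (v n ℚ.* ∑ x n ℚ.- v m ℚ.* ∑ x m) ∣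
      ≤⟨ ℚ.∣p+q∣≤∣p∣+∣q∣ (E n ℚ.- E m) _ ⟩
    ℚ.∣ E n ℚ.- E m ∣ ℚ.+ ℚ.∣ v n ℚ.* ∑ x n ℚ.- v m ℚ.* ∑ x m ∣
      ≤⟨ ℚ.+-mono-≤ (subst (λ k → ℚ.∣ E k ℚ.- E m ∣ ℚ.≤ (v m ℚ.- v k) ℚ.* B) (ℕ.m∸n+n≡m m≤n) (E-variation m (n ℕ.∸ m)))
           (ℚ.≤-trans (ℚ.∣p-q∣≤∣p∣+∣q∣ (v n ℚ.* ∑ x n) (v m ℚ.* ∑ x m))
             (ℚ.+-mono-≤ (∣v*∑∣≤ n (v≥0 n)) (∣v*∑∣≤ m (v≥0 m)))) ⟩
    (v m ℚ.- v n) ℚ.* B ℚ.+ (v n ℚ.* B ℚ.+ v m ℚ.* B)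
      ≡⟨ solve 3 (λ a b d → (a :- b) :* d :+ (b :* d :+ a :* d) := a :* d :+ a :* d) refl (v m) (v n) B ⟩
    v m ℚ.* B ℚ.+ v m ℚ.* B ∎

  dirichlet : (∀ {C ε} → 0ℚ ℚ.≤ C → 0ℚ ℚ.< ε → ∃ λ j → C ℚ.* v j ℚ.≤ ε) → IsCauchy S
  -- Each comparison with the partial sum at `N` costs `2 B v N`, hence the constant `4B`.
  dirichlet v→0 ε ε>0 = let N , 4Bv≤ε = v→0 4B≥0 ε>0 in N , λ m n N≤m N≤n → begin
    ℚ.∣ S m ℚ.- S n ∣
      ≤⟨ ∣p-r∣≤∣p-q∣+∣r-q∣ (S m) (S N) (S n) ⟩
    ℚ.∣ S m ℚ.- S N ∣ ℚ.+ ℚ.∣ S n ℚ.- S N ∣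
      ≤⟨ ℚ.+-mono-≤ (S-variation N N≤m) (S-variation N N≤n) ⟩
    (v N ℚ.* B ℚ.+ v N ℚ.* B) ℚ.+ (v N ℚ.* B ℚ.+ v N ℚ.* B)
      ≡⟨ solve 2 (λ a b → (a :* b :+ a :* b) :+ (a :* b :+ a :* b) := (b :+ b :+ b :+ b) :* a) refl (v N) B ⟩
    (B ℚ.+ B ℚ.+ B ℚ.+ B) ℚ.* v N
      ≤⟨ 4Bv≤ε ⟩
    ε ∎
    where
    B≥0 = ℚ.≤-trans (ℚ.0≤∣p∣ (∑ x 0)) (bounded 0)
    4B≥0 = +-nonNeg (+-nonNeg (+-nonNeg B≥0 B≥0) B≥0) B≥0

-- Real series with rational terms

module RationalSeries {a : ℕ → ℝ} {q : ℕ → ℚ} (rational : ∀ j m → seq (a j) m ≡ q j) where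

  seq-partialSum : ∀ n m → seq (partialSum _+_ 0ℝ a n) m ≡ ∑ q n
  seq-partialSum zero    m = refl
  seq-partialSum (suc n) m = cong₂ ℚ._+_ (seq-partialSum n m) (rational n m)

  -- The sequence of rational partial sums is itself a representative of the limit.
  cauchy⇒converges : IsCauchy (∑ q) → Converges a
  cauchy⇒converges cau = mkℝ (∑ q) cau , λ ε ε>0 →
    let N , close = cau ε ε>0 in N , λ n N≤n δ δ>0 → N , λ m N≤m →
      subst (λ t → ℚ.∣ t ℚ.- ∑ q m ∣ ℚ.≤ ε ℚ.+ δ) (sym (seq-partialSum n m))
        (ℚ.≤-trans (close n m N≤n N≤m) (≤-by _ (ℚ.<⇒≤ δ>0) refl))

  -- Each partial sum is within `ε` of the limit, and the order on representatives allows a further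
  -- slack, also taken to be `ε`; two such comparisons give `4ε`.
  converges⇒cauchy : Converges a → ∀ ε → 0ℚ ℚ.< ε →
    ∃ λ N → ∀ m n → N ℕ.≤ m → N ℕ.≤ n → ℚ.∣ ∑ q m ℚ.- ∑ q n ∣ ℚ.≤ (ε ℚ.+ ε) ℚ.+ (ε ℚ.+ ε)
  converges⇒cauchy (l , lim) ε ε>0 = let N , close = lim ε ε>0 in N , λ m n N≤m N≤n →
    let K , near-m = close m N≤m ε ε>0
        L , near-n = close n N≤n ε ε>0
        k = K ℕ.⊔ L
    in ℚ.≤-trans (∣p-r∣≤∣p-q∣+∣r-q∣ (∑ q m) (seq l k) (∑ q n)) (ℚ.+-mono-≤
      (subst (λ t → ℚ.∣ t ℚ.- seq l k ∣ ℚ.≤ ε ℚ.+ ε) (seq-partialSum m k) (near-m k (ℕ.m≤m⊔n K L)))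
      (subst (λ t → ℚ.∣ t ℚ.- seq l k ∣ ℚ.≤ ε ℚ.+ ε) (seq-partialSum n k) (near-n k (ℕ.m≤n⊔m K L))))

-- The randomly signed series

series : 2^ℕ → ℕ → ℝ
series s n = fromℚ (signed (s n) (measure (word n)))

-- This is the factorization for Dirichlet's test: decreasing weights times signed steps.
seq-↾ : ∀ s A j m → seq ((series s ↾ A) j) m ≡ weight j ℚ.* signed (s j) (mask A step j)
seq-↾ s A j m with A j | s j
... | true  | true  = sym (weight*step j)
... | true  | false = trans (cong ℚ.-_ (sym (weight*step j))) (ℚ.neg-distribʳ-* (weight j) (step j))
... | false | true  = sym (ℚ.*-zeroʳ (weight j))
... | false | false = sym (ℚ.*-zeroʳ (weight j))

BoundedAlong : (List Bool → ℚ) → Pred 2^ℕ 0ℓ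
BoundedAlong D s = ∃ λ B → ∀ n → D (applyUpTo s n) ℚ.≤ B

-- The energy dominates the square of the walk, so a bound `B` on the energy bounds the signed sums
-- of steps by `1 + B`.
bounded⇒converges : ∀ A s → s ∈ BoundedAlong (energy A) → Converges (series s ↾ A)
bounded⇒converges A s (B , bounded) = RationalSeries.cauchy⇒converges (seq-↾ s A)
  (SummationByParts.dirichlet weight (λ j → signed (s j) (mask A step j)) weight-nonNeg weight-antitone
    (1ℚ ℚ.+ B) ∣∑∣≤ weight-vanishes)
  where
  open ℚ.≤-Reasoning
  ∣∑∣≤ : ∀ n → ℚ.∣ ∑ (λ j → signed (s j) (mask A step j)) n ∣ ℚ.≤ 1ℚ ℚ.+ B
  ∣∑∣≤ n = begin
    ℚ.∣ ∑ (λ j → signed (s j) (mask A step j)) n ∣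
      ≡⟨ cong ℚ.∣_∣ (sym (walk-applyUpTo (mask A step) s n)) ⟩
    ℚ.∣ W ∣
      ≤⟨ ∣p∣≤1+p² W ⟩
    1ℚ ℚ.+ W ℚ.* W
      ≤⟨ ℚ.+-monoʳ-≤ 1ℚ (≤-by {W ℚ.* W} _ (p≤q⇒0≤q-p (∑-step²≤9 (length (applyUpTo s n)))) refl) ⟩
    1ℚ ℚ.+ energy A (applyUpTo s n)
      ≤⟨ ℚ.+-monoʳ-≤ 1ℚ (bounded n) ⟩
    1ℚ ℚ.+ B ∎
    where W = walk (mask A step) (applyUpTo s n)

seq-∣series∣ : ∀ s j m → seq ∣ series s j ∣ m ≡ measure (word j)
seq-∣series∣ s j m with s j
... | true  = ℚ.0≤p⇒∣p∣≡p (measure-nonNeg (word j))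
... | false = trans (ℚ.∣-p∣≡∣p∣ (measure (word j))) (ℚ.0≤p⇒∣p∣≡p (measure-nonNeg (word j)))

-- Passing from n to 2n+1 terms raises the partial sum of absolute values by 1.
series-not-absolutelyConvergent : ∀ s → ¬ AbsolutelyConvergent (series s)
series-not-absolutelyConvergent s conv =
  -- With `⅛` the Cauchy estimate becomes `4 · ⅛ = ½`, less than the jump of 1.
  let N , close = RationalSeries.converges⇒cauchy (seq-∣series∣ s) conv ⅛ (from-yes (0ℚ ℚ.<? ⅛))
  in from-no (1ℚ ℚ.≤? ½) (gap⇒1≤ N (close (suc (N ℕ.* 2)) N (ℕ.m≤n⇒m≤1+n (ℕ.m≤m*n N 2)) ℕ.≤-refl))
  where
  ⅛ : ℚ
  ⅛ = ℤ.+ 1 ℚ./ 8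
  H : ℕ → ℚ
  H = ∑ (measure ∘ word)
  H[2n+1]-H[n] : ∀ n → H (suc (n ℕ.* 2)) ℚ.- H n ≡ 1ℚ
  H[2n+1]-H[n] n = trans (cong (ℚ._- H n) (∑-measure-word n))
    (solve 1 (λ h → (con 1ℚ :+ h) :- h := con 1ℚ) refl (H n))
  gap⇒1≤ : ∀ n {ε} → ℚ.∣ H (suc (n ℕ.* 2)) ℚ.- H n ∣ ℚ.≤ ε → 1ℚ ℚ.≤ ε
  gap⇒1≤ n {ε} = subst (λ t → ℚ.∣ t ∣ ℚ.≤ ε) (H[2n+1]-H[n] n)

-- From subseries families to null covers

full : 2^ℕ
full _ = true

bounded⇒conditionallyConvergent : ∀ s → s ∈ BoundedAlong (energy full) → ConditionallyConvergent (series s)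
bounded⇒conditionallyConvergent s bounded = bounded⇒converges full s bounded , series-not-absolutelyConvergent s

subseriesFamily⇒nullCover : (∀ ℓ → ExcludedMiddle ℓ) → ∀ {ι} → SubseriesFamily ι → NullCover ι
subseriesFamily⇒nullCover em {ι} (A , diverging) = X , X-null , X-covers
  where
  -- Adding the energy of `full` at every index, rather than adjoining an extra null set, keeps the
  -- cover indexed by `ι` itself.
  D : ι → List Bool → ℚ
  D i σ = energy (A i) σ ℚ.+ energy full σ

  X : ι → Pred 2^ℕ 0ℓ
  X i = UnboundedAlong (D i)

  X-null : ∀ i → Null (X i)
  X-null i = unbounded-null (+-supermartingale (energy-supermartingale (A i)) (energy-supermartingale full))

  -- The bound on the energy of `full` is later read off from some `D i`, so an index must exist.
  -- The greedy path gives a conditionally convergent series, for which the family supplies one.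
  ι-inhabited : ι
  ι-inhabited = proj₁ (diverging (series s) (bounded⇒conditionallyConvergent s
    (energy full [] , descend-≤ (energy-supermartingale full))))
    where s = descend (energy full)

  ∉X⇒bounded : ∀ i s → ¬ s ∈ X i → s ∈ BoundedAlong (D i)
  ∉X⇒bounded i s s∉X = decidable-stable (em 0ℓ) λ unbounded → s∉X λ B →
    decidable-stable (em 0ℓ) λ below → unbounded
      (B , λ n → ℚ.<⇒≤ (ℚ.≰⇒> λ B≤ → below (n , B≤)))

  X-covers : ∀ s → ∃ λ i → s ∈ X i
  X-covers s = decidable-stable (em 0ℓ) λ uncovered →
    let bounded : ∀ i → s ∈ BoundedAlong (D i)
        bounded i = ∉X⇒bounded i s (λ s∈ → uncovered (i , s∈))
        B , D≤B = bounded ι-inhabited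
        i , div = diverging (series s) (bounded⇒conditionallyConvergent s
          (B , λ n → ℚ.≤-trans (right ι-inhabited (applyUpTo s n)) (D≤B n)))
        C , D≤C = bounded i
    in div (bounded⇒converges (A i) s (C , λ n → ℚ.≤-trans (left i (applyUpTo s n)) (D≤C n)))
    where
    left : ∀ i σ → energy (A i) σ ℚ.≤ D i σ
    left i σ = ≤-by _ (energy-supermartingale full .nonNeg σ) refl
    right : ∀ i σ → energy full σ ℚ.≤ D i σ
    right i σ = ≤-by _ (energy-supermartingale (A i) .nonNeg σ) (ℚ.+-comm (energy (A i) σ) (energy full σ))

theorem11 : (∀ ℓ → ExcludedMiddle ℓ) → ∀ (κ ν : Set) → IsCov𝓛 κ → IsSubseriesNumber ν → κ ↣ ν
theorem11 em κ ν (_ , least) (family , _) = least ν (subseriesFamily⇒nullCover em family)
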